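{- For every sequent $\Gamma\Rightarrow\Delta$: if $\Gamma\Rightarrow\Delta$ is provable in $\mathsf{Grz}_\infty+\mathsf{cut}$, then $\Gamma\Rightarrow\Delta$ is provable in $\mathsf{Grz}_\infty$.
   Context: Formulas are built from $\bot$ and atomic propositions $p$ using $\to$ and the unary modality $\Box$. A sequent is an expression $\Gamma\Rightarrow\Delta$ where $\Gamma,\Delta$ are finite multisets of formulas; for a multiset $\Pi=A_1,\dots,A_n$, $\Box\Pi$ denotes $\Box A_1,\dots,\Box A_n$. The sequent calculus $\mathsf{Grz}_\infty$ has initial sequents $\Gamma,p\Rightarrow p,\Delta$ ($p$ atomic) and $\Gamma,\bot\Rightarrow\Delta$, and the rules: $(\to_L)$ from $\Gamma,B\Rightarrow\Delta$ and $\Gamma\Rightarrow A,\Delta$ infer $\Gamma,A\to B\Rightarrow\Delta$; $(\to_R)$ from $\Gamma,A\Rightarrow B,\Delta$ infer $\Gamma\Rightarrow A\to B,\Delta$; $(\mathsf{refl})$ from $\Gamma,B,\Box B\Rightarrow\Delta$ infer $\Gamma,\Box B\Rightarrow\Delta$; $(\Box)$ from the left premise $\Gamma,\Box\Pi\Rightarrow A,\Delta$ and the right premise $\Box\Pi\Rightarrow A$ infer $\Gamma,\Box\Pi\Rightarrow\Box A,\Delta$. The system $\mathsf{Grz}_\infty+\mathsf{cut}$ additionally has the rule $(\mathsf{cut})$: from $\Gamma\Rightarrow A,\Delta$ and $\Gamma,A\Rightarrow\Delta$ infer $\Gamma\Rightarrow\Delta$. An $\infty$-proof in one of these systems is a possibly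 infinite tree whose nodes are labelled by sequents, built according to the rules of the system, whose leaves are labelled by initial sequents, and such that every infinite branch passes through a right premise of the rule $(\Box)$ infinitely many times. A sequent is provable in the system if there is an $\infty$-proof with root labelled by it. -}

module Defs where

open import Data.List.Base using (List; []; _∷_; _++_; map; head; drop)
open import Data.List.Relation.Binary.Permutation.Propositional using (_↭_)
open import Data.Maybe using (Is-just)
open import Data.Maybe.Base using (Maybe; just; nothing; _>>=_)
open import Data.Maybe.Relation.Binary.Pointwise using (Pointwise)
open import Data.Maybe.Relation.Unary.Any using (Any)
open import Data.Nat.Base using (ℕ; zero; suc; _≤_)
open import Data.Product.Base using (∃; _×_; Σ)

infix  30 □_
infixr 20 _⊃_
infix   3 _⇒_ _≈_

data Formula : Set where
  bot  : Formula
  atom : ℕ → Formula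
  _⊃_  : Formula → Formula → Formula
  □_   : Formula → Formula

-- A finite multiset of formulas is represented by a list; two lists represent
-- the same multiset when they are permutations of each other, so _≈_ is the
-- equality of sequents.
record Sequent : Set where
  constructor _⇒_
  field
    antecedent : List Formula
    succedent  : List Formula

_≈_ : Sequent → Sequent → Set
(Γ ⇒ Δ) ≈ (Γ′ ⇒ Δ′) = (Γ ↭ Γ′) × (Δ ↭ Δ′)

data Calculus : Set where
  Grz∞     : Calculus
  Grz∞+cut : Calculus

-- Rule c Ss S: the sequents Ss, in this order, are the premises and S the
-- conclusion of an application of a rule of c.  Initial sequents are the
-- conclusions of rules without premises.
data Rule : Calculus → List Sequent → Sequent → Set where

  init-atom : ∀ {c} Γ Δ p →
    Rule c [] (atom p ∷ Γ ⇒ atom p ∷ Δ)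

  init-bot : ∀ {c} Γ Δ →
    Rule c [] (bot ∷ Γ ⇒ Δ)

  →L : ∀ {c} Γ Δ A B →
    Rule c ((B ∷ Γ ⇒ Δ) ∷ (Γ ⇒ A ∷ Δ) ∷ [])
           (A ⊃ B ∷ Γ ⇒ Δ)

  →R : ∀ {c} Γ Δ A B →
    Rule c ((A ∷ Γ ⇒ B ∷ Δ) ∷ [])
           (Γ ⇒ A ⊃ B ∷ Δ)

  reflL : ∀ {c} Γ Δ B →
    Rule c ((B ∷ □ B ∷ Γ ⇒ Δ) ∷ [])
           (□ B ∷ Γ ⇒ Δ)

  box : ∀ {c} Γ Π Δ A →
    Rule c ((Γ ++ map □_ Π ⇒ A ∷ Δ) ∷ (map □_ Π ⇒ A ∷ []) ∷ [])
           (Γ ++ map □_ Π ⇒ □ A ∷ Δ)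

  cut : ∀ Γ Δ A →
    Rule Grz∞+cut ((Γ ⇒ A ∷ Δ) ∷ (A ∷ Γ ⇒ Δ) ∷ [])
                  (Γ ⇒ Δ)

record Inference (c : Calculus) : Set where
  constructor infer
  field
    {premises}   : List Sequent
    {conclusion} : Sequent
    rule         : Rule c premises conclusion

open Inference public

-- Premises are numbered from 0, so the right premise of box has number 1.
premise : ∀ {c} → Inference c → ℕ → Maybe Sequent
premise i k = head (drop k (premises i))

data IsRightBoxPremise {c : Calculus} : Inference c → ℕ → Set where
  right : ∀ {Γ Π Δ A} → IsRightBoxPremise (infer (box Γ Π Δ A)) 1

Concludes : ∀ {c} → Sequent → Inference c → Set
Concludes S i = S ≈ conclusion i

-- A node of a tree is identified by its address: the child numbers chosen on
-- the way from the root to the node, the most recent choice first.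
Address : Set
Address = List ℕ

-- Trees that may be infinite are given by a function on addresses, with value
-- nothing at the addresses that are not nodes.  A node carries the inference of
-- which its sequent is the conclusion.  Pointwise relates just to just and
-- nothing to nothing, so `children` says that k ∷ a is a node exactly when a is
-- a node whose inference has a premise number k, and that this premise is then
-- the sequent at k ∷ a.
record Tree (c : Calculus) (S : Sequent) : Set where
  field
    node     : Address → Maybe (Inference c)
    root     : Pointwise Concludes (just S) (node [])
    children : ∀ a k →
      Pointwise Concludes (node a >>= λ i → premise i k) (node (k ∷ a))

open Tree public

-- The address reached after n steps when step m goes to child number f m.
prefix : (ℕ → ℕ) → ℕ → Address
prefix f zero    = []
prefix f (suc n) = f n ∷ prefix f n

IsInfiniteBranch : ∀ {c S} → Tree c S → (ℕ → ℕ) → Set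
IsInfiniteBranch t f = ∀ n → Is-just (node t (prefix f n))

PassesRightAt : ∀ {c S} → Tree c S → (ℕ → ℕ) → ℕ → Set
PassesRightAt t f n = Any (λ i → IsRightBoxPremise i (f n)) (node t (prefix f n))

Is∞Proof : ∀ {c S} → Tree c S → Set
Is∞Proof t = ∀ f → IsInfiniteBranch t f →
  ∀ n → ∃ λ m → n ≤ m × PassesRightAt t f m

Provable : Calculus → Sequent → Set
Provable c S = Σ (Tree c S) Is∞Proof

{-# OPTIONS --safe #-}

-- Cut is eliminated semantically.  A finite tree model refuting a sequent
-- refutes, at each inference (cut included), some premise at the same world or
-- above, and strictly above if that premise is a right premise of box; in an
-- ∞-proof this would trace an infinite branch with finitely many right
-- premises.  Conversely a sequent either has a countermodel or a cut-free
-- ∞-proof: the right premises that matter for a given sequent form a finite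
-- list, from which we delete those with countermodels until every remaining one
-- can be derived by a finite tree of rules whose open leaves are right premises
-- on the list.  Plugging these finite trees into each other gives the ∞-proof.
module Submission where

open import Data.Empty using (⊥; ⊥-elim)
open import Data.List.Base
  using (List; []; _∷_; _++_; [_]; map; head; drop; length; filter; deduplicate;
         concatMap; cartesianProductWith)
open import Data.List.Membership.Propositional using (_∈_; find; lose)
open import Data.List.Membership.Propositional.Properties
  using (∈-∃++; ∈-++⁻; ∈-++⁺ˡ; ∈-++⁺ʳ; ∈-map⁺; ∈-map⁻; ∈-filter⁺; ∈-filter⁻;
         ∈-deduplicate⁺; ∈-concatMap⁺; ∈-concatMap⁻; ∈-cartesianProductWith⁺;
         ∈-cartesianProductWith⁻)
open import Data.List.Properties using (length-++; ++-identityʳ)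
open import Data.List.Relation.Binary.Permutation.Propositional
  using (_↭_; ↭-refl; ↭-sym; ↭-trans; ↭-reflexive; prep)
open import Data.List.Relation.Binary.Permutation.Propositional.Properties
  using (All-resp-↭; shift) renaming (map⁺ to ↭-map⁺)
open import Data.List.Relation.Unary.All as All using (All; []; _∷_)
import Data.List.Relation.Unary.All.Properties as All
open import Data.List.Relation.Unary.AllPairs using ([]; _∷_)
open import Data.List.Relation.Unary.Any as Any using (Any; here; there)
open import Data.List.Relation.Unary.Unique.Propositional using (Unique)
import Data.List.Relation.Unary.Unique.Propositional.Properties as Unique
import Data.List.Relation.Unary.Unique.DecPropositional.Properties as UniqueDec
open import Data.Maybe.Base as Maybe using (Maybe; just; nothing; _>>=_)
open import Data.Maybe.Relation.Binary.Pointwise as Pointwise using (Pointwise)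
open import Data.Maybe.Relation.Unary.All as MAll using (just; nothing)
open import Data.Maybe.Relation.Unary.Any as MAny using (just)
open import Data.Nat.Base using (ℕ; zero; suc; _+_; _⊔_; _≤_; _<_; s≤s)
open import Data.Nat.Induction using (<-wellFounded)
open import Data.Nat.ListAction using (sum)
open import Data.Nat.ListAction.Properties using (sum-↭)
import Data.Nat.Properties as ℕ
open import Data.Nat.Tactic.RingSolver using (solve-∀)
open import Data.Product.Base using (∃; _×_; _,_; proj₁; proj₂)
open import Data.Sum.Base using (_⊎_; inj₁; inj₂; swap)
open import Data.Unit.Base using (⊤; tt)
open import Function.Base using (_∘_; id)
open import Induction.WellFounded using (Acc; acc)
open import Relation.Binary.Definitions using (DecidableEquality)
open import Relation.Binary.PropositionalEquality
  using (_≡_; _≢_; refl; sym; trans; cong; subst)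
open import Relation.Nullary using (¬_; Dec; yes; no; contradiction)
open import Relation.Nullary.Decidable using (map′)
open import Relation.Unary using (Decidable)

open import Defs

≈-refl : ∀ {S} → S ≈ S
≈-refl = ↭-refl , ↭-refl

≈-trans : ∀ {S T U} → S ≈ T → T ≈ U → S ≈ U
≈-trans (p , q) (p′ , q′) = ↭-trans p p′ , ↭-trans q q′

-- Finite derivations and ∞-proofs

-- Finite derivations whose leaves may also be right premises of box in X.
data Derivable (X : Sequent → Set) (S : Sequent) : Set where
  derive : (i : Inference Grz∞) → Concludes S i →
    (∀ k → MAll.All (λ P → Derivable X P ⊎ IsRightBoxPremise i k × X P)
                    (premise i k)) →
    Derivable X S

Derivable-resp-≈ : ∀ {X S T} → S ≈ T → Derivable X T → Derivable X S
Derivable-resp-≈ S≈T (derive i T≈ ds) = derive i (≈-trans S≈T T≈) ds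

no-premise : ∀ {Q : ℕ → Sequent → Set} k → MAll.All (Q k) (head (drop k []))
no-premise zero    = nothing
no-premise (suc k) = nothing

one-premise : ∀ {Q : ℕ → Sequent → Set} {S} → Q 0 S →
  ∀ k → MAll.All (Q k) (head (drop k (S ∷ [])))
one-premise         q zero    = just q
one-premise {Q = Q} q (suc k) = no-premise {Q ∘ suc} k

two-premises : ∀ {Q : ℕ → Sequent → Set} {S T} → Q 0 S → Q 1 T →
  ∀ k → MAll.All (Q k) (head (drop k (S ∷ T ∷ [])))
two-premises         q r zero    = just q
two-premises {Q = Q} q r (suc k) = one-premise {Q ∘ suc} r k

module Unfold {X : Sequent → Set} (expand : ∀ {S} → X S → Derivable X S) where

  -- A node of the tree under construction is represented by the finite derivation still to be
  -- unfolded there; an open leaf is replaced by its expansion. Since trees are functions on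
  -- addresses, recursion on the address takes the place of corecursion.
  State : Set
  State = ∃ (Derivable X)

  inference : State → Inference Grz∞
  inference (_ , derive i _ _) = i

  Child : Inference Grz∞ → ℕ → Sequent → Set
  Child i k P = Derivable X P ⊎ IsRightBoxPremise i k × X P

  follow : ∀ {i k m} → MAll.All (Child i k) m → Maybe State
  follow nothing               = nothing
  follow (just (inj₁ d))       = just (_ , d)
  follow (just (inj₂ (_ , x))) = just (_ , expand x)

  child : ℕ → State → Maybe State
  child k (_ , derive i _ ds) = follow (ds k)

  concludes : ∀ {S} (d : Derivable X S) → Concludes S (inference (S , d))
  concludes (derive i S≈ _) = S≈

  follow-concludes : ∀ {i k m} (ds : MAll.All (Child i k) m) →
    Pointwise Concludes m (Maybe.map inference (follow ds))
  follow-concludes nothing               = Pointwise.nothing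
  follow-concludes (just (inj₁ d))       = Pointwise.just (concludes d)
  follow-concludes (just (inj₂ (_ , x))) = Pointwise.just (concludes (expand x))

  module _ {S : Sequent} (d : Derivable X S) where

    walk : Address → Maybe State
    walk []      = just (S , d)
    walk (k ∷ a) = walk a >>= child k

    tree : Tree Grz∞ S
    tree .node a = Maybe.map inference (walk a)
    tree .root   = Pointwise.just (concludes d)
    tree .children a k with walk a
    ... | nothing                  = Pointwise.nothing
    ... | just (_ , derive _ _ ds) = follow-concludes (ds k)

    module _ (f : ℕ → ℕ) (branch : IsInfiniteBranch tree f) where

      mutual
        -- Structural recursion on the finite derivation `e`: a step of the branch either goes down
        -- to a subderivation or crosses an open leaf, which is a right premise of `box`.
        progress : ∀ n {T} (e : Derivable X T) →
          walk (prefix f n) ≡ just (T , e) → ∃ λ m → n ≤ m × PassesRightAt tree f m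
        progress n (derive i T≈ ds) eq =
          progress-child n (ds (f n)) (cong (Maybe.map inference) eq)
            (cong (_>>= child (f n)) eq)

        progress-child : ∀ n {i m} (ds : MAll.All (Child i (f n)) m) →
          node tree (prefix f n) ≡ just i → walk (prefix f (suc n)) ≡ follow ds →
          ∃ λ m → n ≤ m × PassesRightAt tree f m
        -- There is no premise to enter, although the branch has a node at depth `suc n`.
        progress-child n nothing _ eq
          with () ← subst (MAny.Any _) (cong (Maybe.map inference) eq) (branch (suc n))
        progress-child n (just (inj₁ e)) _ eq =
          let m , n<m , passes = progress (suc n) e eq in m , ℕ.<⇒≤ n<m , passes
        progress-child n (just (inj₂ (r , _))) eq _ =
          n , ℕ.≤-refl , subst (MAny.Any _) (sym eq) (just r)

    is∞Proof : Is∞Proof tree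
    is∞Proof f branch n with walk (prefix f n) in eq | branch n
    ... | just (_ , e) | _ = progress f branch n e eq

-- A coinduction principle: appeals to `X` may be nested forever, because each one is guarded by a
-- right premise of `box`.
postfixed⇒provable : ∀ {X S} → (∀ {T} → X T → Derivable X T) →
  Derivable X S → Provable Grz∞ S
postfixed⇒provable expand d = tree d , is∞Proof d
  where open Unfold expand

-- Formulas

infix 4 _≟_

_≟_ : DecidableEquality Formula
bot     ≟ bot     = yes refl
bot     ≟ atom _  = no λ ()
bot     ≟ (_ ⊃ _) = no λ ()
bot     ≟ (□ _)   = no λ ()
atom _  ≟ bot     = no λ ()
atom p  ≟ atom q  = map′ (cong atom) (λ { refl → refl }) (p ℕ.≟ q)
atom _  ≟ (_ ⊃ _) = no λ ()
atom _  ≟ (□ _)   = no λ ()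
(_ ⊃ _) ≟ bot     = no λ ()
(_ ⊃ _) ≟ atom _  = no λ ()
(A ⊃ B) ≟ (C ⊃ D) with A ≟ C | B ≟ D
... | yes refl | yes refl = yes refl
... | no A≢C   | _        = no λ { refl → A≢C refl }
... | _        | no B≢D   = no λ { refl → B≢D refl }
(A ⊃ B) ≟ (□ _)   = no λ ()
(□ _)   ≟ bot     = no λ ()
(□ _)   ≟ atom _  = no λ ()
(□ _)   ≟ (_ ⊃ _) = no λ ()
(□ A)   ≟ (□ B)   = map′ (cong □_) (λ { refl → refl }) (A ≟ B)

open import Data.List.Membership.DecPropositional _≟_ using (_∈?_)

-- Models

-- A world of a finite tree, identified with the subtree above it: the list gives
-- the true atoms.
data Model : Set where
  world : List Formula → List Model → Model

infix 4 _≼_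

-- Accessibility read backwards: the worlds seen from a world are its subtrees, itself included.
-- These are the finite reflexive trees of Grz.
data _≼_ : Model → Model → Set where
  here  : ∀ {m} → m ≼ m
  above : ∀ {m V ms} → Any (m ≼_) ms → m ≼ world V ms

mutual
  ≼-trans : ∀ {l m n} → l ≼ m → m ≼ n → l ≼ n
  ≼-trans l≼m here      = l≼m
  ≼-trans l≼m (above i) = above (≼-trans-Any l≼m i)

  ≼-trans-Any : ∀ {l m ms} → l ≼ m → Any (m ≼_) ms → Any (l ≼_) ms
  ≼-trans-Any l≼m (here m≼n) = here (≼-trans l≼m m≼n)
  ≼-trans-Any l≼m (there i)  = there (≼-trans-Any l≼m i)

mutual
  height : Model → ℕ
  height (world _ ms) = suc (maxHeight ms)

  maxHeight : List Model → ℕ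
  maxHeight []       = 0
  maxHeight (m ∷ ms) = height m ⊔ maxHeight ms

mutual
  height-mono : ∀ {m n} → m ≼ n → height m ≤ height n
  height-mono here      = ℕ.≤-refl
  height-mono (above i) = ℕ.m≤n⇒m≤1+n (height≤maxHeight i)

  height≤maxHeight : ∀ {m ms} → Any (m ≼_) ms → height m ≤ maxHeight ms
  height≤maxHeight (here m≼n) = ℕ.m≤n⇒m≤n⊔o _ (height-mono m≼n)
  height≤maxHeight (there i)  = ℕ.m≤n⇒m≤o⊔n _ (height≤maxHeight i)

module _ {P : Model → Set} (P? : Decidable P) where

  mutual
    -- A finite tree can be searched, so the failure of a boxed formula yields an actual world
    -- refuting its body, without classical logic.
    everywhere? : ∀ m → (∀ n → n ≼ m → P n) ⊎ (∃ λ n → n ≼ m × ¬ P n)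
    everywhere? (world V ms) with P? (world V ms) | everywhereAny? ms
    ... | no ¬p | _                   = inj₂ (_ , here , ¬p)
    ... | yes _ | inj₂ (n , i , ¬p)   = inj₂ (n , above i , ¬p)
    ... | yes p | inj₁ ps             = inj₁ λ { _ here → p ; _ (above i) → ps _ i }

    everywhereAny? : ∀ ms →
      (∀ n → Any (n ≼_) ms → P n) ⊎ (∃ λ n → Any (n ≼_) ms × ¬ P n)
    everywhereAny? []       = inj₁ λ _ ()
    everywhereAny? (m ∷ ms) with everywhere? m | everywhereAny? ms
    ... | inj₂ (n , i , ¬p) | _                 = inj₂ (n , here i , ¬p)
    ... | inj₁ _            | inj₂ (n , i , ¬p) = inj₂ (n , there i , ¬p)
    ... | inj₁ ps           | inj₁ qs           =
      inj₁ λ { _ (here i) → ps _ i ; _ (there i) → qs _ i }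

infix 4 _⊩_ _⊩?_

-- Only the atoms in the valuation are consulted, which lets the antecedent of a saturated sequent
-- serve as a valuation unchanged.
_⊩_ : Model → Formula → Set
m          ⊩ bot     = ⊥
world V ms ⊩ atom p  = atom p ∈ V
m          ⊩ (A ⊃ B) = m ⊩ A → m ⊩ B
m          ⊩ (□ A)   = ∀ n → n ≼ m → n ⊩ A

_⊩?_ : ∀ m A → Dec (m ⊩ A)
m          ⊩? bot     = no λ ()
world V ms ⊩? atom p  = atom p ∈? V
m          ⊩? (A ⊃ B) with m ⊩? A | m ⊩? B
... | _      | yes b = yes λ _ → b
... | no ¬a  | no _  = yes λ a → contradiction a ¬a
... | yes a  | no ¬b = no λ f → ¬b (f a)
m          ⊩? (□ A) with everywhere? (_⊩? A) m
... | inj₁ p              = yes p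
... | inj₂ (n , n≼m , ¬a) = no λ p → ¬a (p n n≼m)

⊩-□⁺ : ∀ {A V ms} → world V ms ⊩ A → All (_⊩ □ A) ms → world V ms ⊩ □ A
⊩-□⁺ a bs _ here      = a
⊩-□⁺ a bs _ (above i) = All.lookupWith (λ b n≼m → b _ n≼m) bs i

⊩-mono-□ : ∀ {m n} Π → n ≼ m → All (m ⊩_) (map □_ Π) → All (n ⊩_) (map □_ Π)
⊩-mono-□ []      n≼m []       = []
⊩-mono-□ (B ∷ Π) n≼m (b ∷ bs) = (λ l l≼n → b l (≼-trans l≼n n≼m)) ∷ ⊩-mono-□ Π n≼m bs

Refutes : Model → Sequent → Set
Refutes m (Γ ⇒ Δ) = All (m ⊩_) Γ × All (λ A → ¬ m ⊩ A) Δ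

Refutes-resp-≈ : ∀ {m S T} → S ≈ T → Refutes m S → Refutes m T
Refutes-resp-≈ (p , q) (γ , δ) = All-resp-↭ p γ , All-resp-↭ q δ

-- Soundness

-- A computed form of `IsRightBoxPremise`: it reduces to `⊥` on the other rules, with no unification
-- of indices that contain `_++_`.
IsRight : ∀ {c} → Inference c → ℕ → Set
IsRight (infer (box _ _ _ _)) 1 = ⊤
IsRight _                     _ = ⊥

isRight : ∀ {c} {i : Inference c} {k} → IsRightBoxPremise i k → IsRight i k
isRight right = tt

record RefutedPremise {c} (i : Inference c) (m : Model) : Set where
  constructor refuted
  field
    index   : ℕ
    {sequent} : Sequent
    at      : premise i index ≡ just sequent
    model   : Model
    refutes : Refutes model sequent
    lower   : height model ≤ height m
    strict  : IsRight i index → height model < height m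

-- Soundness of single rules, in contrapositive form. Forcing is decidable, so `cut` is handled by
-- asking whether the cut formula holds at `m`.
refutedPremise : ∀ {c Ss S} (r : Rule c Ss S) m → Refutes m S →
  RefutedPremise (infer r) m
refutedPremise (init-atom Γ Δ p) m (a ∷ _ , ¬a ∷ _) = contradiction a ¬a
refutedPremise (init-bot Γ Δ) m (() ∷ _ , _)
refutedPremise (→L Γ Δ A B) m (f ∷ γ , δ) with m ⊩? A
... | yes a = refuted 0 refl m (f a ∷ γ , δ) ℕ.≤-refl λ ()
... | no ¬a = refuted 1 refl m (γ , ¬a ∷ δ) ℕ.≤-refl λ ()
refutedPremise (→R Γ Δ A B) m (γ , ¬f ∷ δ) with m ⊩? A | m ⊩? B
... | _     | yes b = contradiction (λ _ → b) ¬f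
... | no ¬a | no _  = contradiction (λ a → contradiction a ¬a) ¬f
... | yes a | no ¬b = refuted 0 refl m (a ∷ γ , ¬b ∷ δ) ℕ.≤-refl λ ()
refutedPremise (reflL Γ Δ B) m (b ∷ γ , δ) =
  refuted 0 refl m (b m here ∷ b ∷ γ , δ) ℕ.≤-refl λ ()
refutedPremise (box Γ Π Δ A) m (γ , ¬b ∷ δ) with everywhere? (_⊩? A) m
... | inj₁ b                    = contradiction b ¬b
... | inj₂ (_ , here , ¬a)      = refuted 0 refl m (γ , ¬a ∷ δ) ℕ.≤-refl λ ()
-- Of the antecedent only the boxed formulas persist to the world `n` strictly above, and these are
-- all that the right premise retains.
... | inj₂ (n , above i , ¬a)   =
  refuted 1 refl n (⊩-mono-□ Π (above i) (All.++⁻ʳ Γ γ) , ¬a ∷ [])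
    (ℕ.m≤n⇒m≤1+n (height≤maxHeight i)) (λ _ → s≤s (height≤maxHeight i))
refutedPremise (cut Γ Δ A) m (γ , δ) with m ⊩? A
... | yes a = refuted 1 refl m (a ∷ γ , δ) ℕ.≤-refl λ ()
... | no ¬a = refuted 0 refl m (γ , ¬a ∷ δ) ℕ.≤-refl λ ()

-- In `below`, monotonicity carries the bound `b` to the next strict drop, which lowers it by one; a
-- bound of zero leaves no room for a drop.
¬eventually-decreasing : (h : ℕ → ℕ) → (∀ n → h (suc n) ≤ h n) →
  ¬ (∀ n → ∃ λ m → n ≤ m × h (suc m) < h m)
¬eventually-decreasing h mono decr = below (h 0) 0 ℕ.≤-refl
  where
  antitone : ∀ {n m} → n ≤ m → h m ≤ h n
  antitone {n} {m} n≤m with ℕ.m≤n⇒m<n∨m≡n n≤m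
  antitone {n} {suc m} _ | inj₁ n<m  = ℕ.≤-trans (mono m) (antitone (ℕ.≤-pred n<m))
  ...                    | inj₂ refl = ℕ.≤-refl

  below : ∀ b n → h n ≤ b → ⊥
  below b n hn≤b with m , n≤m , lt ← decr n
    with ℕ.<-≤-trans lt (ℕ.≤-trans (antitone n≤m) hn≤b)
  below (suc b) n hn≤b | s≤s le = below b _ le

module _ {c S} (t : Tree c S) (proof : Is∞Proof t) where

  record Position : Set where
    constructor position
    field
      address : Address
      {inf}   : Inference c
      at      : node t address ≡ just inf
      model   : Model
      refutes : Refutes model (conclusion inf)

  open Position

  step : (q : Position) → RefutedPremise (inf q) (model q)
  step q = refutedPremise (rule (inf q)) (model q) (refutes q)

  -- The two equations are recorded because `advance` does not reduce until the node at the new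
  -- address is known.
  advance : ∀ q → ∃ λ q′ → address q′ ≡ RefutedPremise.index (step q) ∷ address q
                        × model q′ ≡ RefutedPremise.model (step q)
  advance (position a {i} at m ref)
    with refuted k e n ref′ _ _ ← refutedPremise (rule i) m ref
    with node t (k ∷ a) in eq
       | subst (λ x → Pointwise Concludes x (node t (k ∷ a)))
           (trans (cong (_>>= λ j → premise j k) at) e) (children t a k)
  -- The conclusion at the child agrees with the refuted premise only up to permutation.
  ... | just j | Pointwise.just P≈j =
    position (k ∷ a) eq n (Refutes-resp-≈ P≈j ref′) , refl , refl

  -- The branch `choice` always enters the refuted premise. Along it heights never rise, while
  -- `Is∞Proof` supplies infinitely many strict drops.
  unrefutable : ∀ m → ¬ Refutes m S
  unrefutable m ref with node t [] in eq | root t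
  ... | just i | Pointwise.just S≈ =
    ¬eventually-decreasing (height ∘ model ∘ pos) descends λ n →
      let k , n≤k , passes = proof choice onBranch n
      in k , n≤k , subst (_< height (model (pos k)))
                     (cong height (sym (proj₂ (proj₂ (advance (pos k))))))
                     (RefutedPremise.strict (step (pos k)) (strictly k passes))
    where
    pos : ℕ → Position
    pos zero    = position [] eq m (Refutes-resp-≈ S≈ ref)
    pos (suc n) = proj₁ (advance (pos n))

    choice : ℕ → ℕ
    choice n = RefutedPremise.index (step (pos n))

    address-pos : ∀ n → address (pos n) ≡ prefix choice n
    address-pos zero    = refl
    address-pos (suc n) =
      trans (proj₁ (proj₂ (advance (pos n)))) (cong (choice n ∷_) (address-pos n))

    node-pos : ∀ n → node t (prefix choice n) ≡ just (inf (pos n))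
    node-pos n = trans (cong (node t) (sym (address-pos n))) (at (pos n))

    onBranch : IsInfiniteBranch t choice
    onBranch n = subst (MAny.Any _) (sym (node-pos n)) (just tt)

    strictly : ∀ n → PassesRightAt t choice n → IsRight (inf (pos n)) (choice n)
    strictly n passes =
      isRight (MAny.drop-just (subst (MAny.Any _) (node-pos n) passes))

    descends : ∀ n → height (model (pos (suc n))) ≤ height (model (pos n))
    descends n = subst (_≤ height (model (pos n)))
      (cong height (sym (proj₂ (proj₂ (advance (pos n))))))
      (RefutedPremise.lower (step (pos n)))

-- Lists

∈-remove : ∀ {A : Set} {x y : A} xs {ys} → y ∈ xs ++ x ∷ ys → x ≢ y → y ∈ xs ++ ys
∈-remove xs i x≢y with ∈-++⁻ xs i
... | inj₁ j           = ∈-++⁺ˡ j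
... | inj₂ (here refl) = contradiction refl x≢y
... | inj₂ (there j)   = ∈-++⁺ʳ xs j

-- Without repetitions, membership gives inclusion of multisets: deleting one occurrence of `x` from
-- `ys` keeps all other elements of `xs`.
unique-⊆⇒↭ : ∀ {A : Set} {xs ys : List A} → Unique xs → All (_∈ ys) xs →
  ∃ λ zs → ys ↭ zs ++ xs
unique-⊆⇒↭ {ys = ys} [] [] = ys , ↭-reflexive (sym (++-identityʳ ys))
unique-⊆⇒↭ {xs = x ∷ xs} (x∉ ∷ u) (x∈ ∷ ⊆ys) with as , bs , refl ← ∈-∃++ x∈ =
  let zs , p = unique-⊆⇒↭ u (All.zipWith (λ (i , x≢) → ∈-remove as i x≢) (⊆ys , x∉))
  in zs , ↭-trans (shift x as bs) (↭-trans (prep x p) (↭-sym (shift x zs xs)))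

sublists : ∀ {A : Set} → List A → List (List A)
sublists []       = [ [] ]
sublists (x ∷ xs) = map (x ∷_) (sublists xs) ++ sublists xs

filter∈sublists : ∀ {A : Set} {P : A → Set} (P? : Decidable P) xs →
  filter P? xs ∈ sublists xs
filter∈sublists P? []       = here refl
filter∈sublists P? (x ∷ xs) with P? x
... | yes _ = ∈-++⁺ˡ (∈-map⁺ (x ∷_) (filter∈sublists P? xs))
... | no _  = ∈-++⁺ʳ _ (filter∈sublists P? xs)

∈-sublists : ∀ {A : Set} (xs : List A) {ys x} → ys ∈ sublists xs → x ∈ ys → x ∈ xs
∈-sublists []       (here refl) ()
∈-sublists (x ∷ xs) i j with ∈-++⁻ (map (x ∷_) (sublists xs)) i
... | inj₂ i′ = there (∈-sublists xs i′ j)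
... | inj₁ i′ with _ , k , refl ← ∈-map⁻ (x ∷_) i′ | j
...   | here refl = here refl
...   | there j′  = there (∈-sublists xs k j′)

any⊎all : ∀ {A : Set} {P Q : A → Set} {xs} → All (λ x → P x ⊎ Q x) xs →
  Any P xs ⊎ All Q xs
any⊎all []            = inj₂ []
any⊎all (inj₁ p ∷ _)  = inj₁ (here p)
any⊎all (inj₂ q ∷ rs) with any⊎all rs
... | inj₁ i  = inj₁ (there i)
... | inj₂ qs = inj₂ (q ∷ qs)

-- Subformulas

infix 4 _◁_

data _◁_ : Formula → Formula → Set where
  ⊃ˡ : ∀ {A B} → A ◁ A ⊃ B
  ⊃ʳ : ∀ {A B} → B ◁ A ⊃ B
  □◁ : ∀ {A} → A ◁ □ A

Closed : List Formula → Set
Closed U = ∀ {A B} → A ◁ B → B ∈ U → A ∈ U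

subformulas : Formula → List Formula
subformulas bot      = [ bot ]
subformulas (atom p) = [ atom p ]
subformulas (A ⊃ B)  = A ⊃ B ∷ subformulas A ++ subformulas B
subformulas (□ A)    = □ A ∷ subformulas A

self∈subformulas : ∀ A → A ∈ subformulas A
self∈subformulas bot      = here refl
self∈subformulas (atom p) = here refl
self∈subformulas (A ⊃ B)  = here refl
self∈subformulas (□ A)    = here refl

subformulas-closed : ∀ C → Closed (subformulas C)
subformulas-closed bot      () (here refl)
subformulas-closed (atom p) () (here refl)
subformulas-closed (C ⊃ D) ⊃ˡ (here refl) = there (∈-++⁺ˡ (self∈subformulas C))
subformulas-closed (C ⊃ D) ⊃ʳ (here refl) =
  there (∈-++⁺ʳ (subformulas C) (self∈subformulas D))
subformulas-closed (C ⊃ D) A◁B (there i) with ∈-++⁻ (subformulas C) i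
... | inj₁ j = there (∈-++⁺ˡ (subformulas-closed C A◁B j))
... | inj₂ j = there (∈-++⁺ʳ (subformulas C) (subformulas-closed D A◁B j))
subformulas-closed (□ C) □◁ (here refl)  = there (self∈subformulas C)
subformulas-closed (□ C) A◁B (there i)   = there (subformulas-closed C A◁B i)

concatMap-subformulas-closed : ∀ Γ → Closed (concatMap subformulas Γ)
concatMap-subformulas-closed Γ A◁B i =
  ∈-concatMap⁺ subformulas
    (Any.map (subformulas-closed _ A◁B) (∈-concatMap⁻ subformulas {xs = Γ} i))

-- Completeness

Countermodel : Sequent → Set
Countermodel S = ∃ λ m → Refutes m S

size : Formula → ℕ
size bot      = 0
size (atom p) = 0
size (A ⊃ B)  = suc (size A) + suc (size B)
size (□ A)    = suc (suc (size A))

weight : List Formula → ℕ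
weight Γ = sum (map (suc ∘ size) Γ)

sizes : List Formula → ℕ
sizes Γ = sum (map size Γ)

-- Reduces a decrease of the measure to an identity for the ring solver, with slack `k`.
≡+⇒< : ∀ {m n} k → n ≡ suc (m + k) → m < n
≡+⇒< k refl = s≤s (ℕ.m≤m+n _ k)

-- In an antecedent from which B has already been split off □ B, only the worlds
-- strictly above still have to force B.
ForcesAbove : Model → Formula → Set
ForcesAbove m            bot      = ⊤
ForcesAbove m            (atom p) = m ⊩ atom p
ForcesAbove m            (A ⊃ B)  = ⊤
ForcesAbove (world V ms) (□ A)    = All (_⊩ □ A) ms

-- `bot` is refuted everywhere and `saturate` files no implication on the right, hence the two
-- trivial clauses.
RefutesLiteral : Model → Formula → Set
RefutesLiteral m bot      = ⊤
RefutesLiteral m (atom p) = ¬ m ⊩ atom p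
RefutesLiteral m (A ⊃ B)  = ⊤
RefutesLiteral m (□ A)    = ¬ m ⊩ □ A

module Search (U : List Formula) (closed : Closed U) where

  boxed : List Formula
  boxed = filter (λ B → □ B ∈? U) (deduplicate _≟_ U)

  boxed-unique : Unique boxed
  boxed-unique = Unique.filter⁺ _ (UniqueDec.deduplicate-! _≟_ U)

  ∈-boxed⁺ : ∀ {B} → □ B ∈ U → B ∈ boxed
  ∈-boxed⁺ i = ∈-filter⁺ _ (∈-deduplicate⁺ _≟_ (closed □◁ i)) i

  ∈-boxed⁻ : ∀ {B} → B ∈ boxed → □ B ∈ U
  ∈-boxed⁻ i = proj₂ (∈-filter⁻ (λ B → □ B ∈? U) {xs = deduplicate _≟_ U} i)

  rightPremise : List Formula → Formula → Sequent
  rightPremise Π A = map □_ Π ⇒ A ∷ []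

  rightPremises : List Sequent
  rightPremises = cartesianProductWith rightPremise (sublists boxed) U

  -- Dropping repetitions and fixing the order leaves only finitely many right
  -- premises to consider.
  boxes : List Formula → List Formula
  boxes L = filter (λ B → □ B ∈? L) boxed

  boxes-split : ∀ L → ∃ λ Γ → L ↭ Γ ++ map □_ (boxes L)
  boxes-split L = unique-⊆⇒↭
    (Unique.map⁺ (λ { refl → refl }) (Unique.filter⁺ _ boxed-unique))
    (All.map⁺ (All.all-filter (λ B → □ B ∈? L) boxed))

  rightPremise∈ : ∀ L {A} → A ∈ U → rightPremise (boxes L) A ∈ rightPremises
  rightPremise∈ L = ∈-cartesianProductWith⁺ rightPremise (filter∈sublists _ boxed)

  _⊆U : List Formula → Set
  Γ ⊆U = All (_∈ U) Γ

  rightPremises⊆U : ∀ {S} → S ∈ rightPremises →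
    Sequent.antecedent S ⊆U × Sequent.succedent S ⊆U
  rightPremises⊆U i
    with Π , A , j , k , refl ← ∈-cartesianProductWith⁻ rightPremise (sublists boxed) U i =
    All.map⁺ (All.tabulate (∈-boxed⁻ ∘ ∈-sublists boxed j)) , k ∷ []

  -- Proof search with a given list of open right premises

  module Saturate
    (X : List Sequent)
    (decided : ∀ {S} → S ∈ rightPremises → S ∈ X ⊎ Countermodel S)
    where

    -- Γ and Δ remain to be decomposed; L and R consist of literals.
    record Refutation (Γ L Δ R : List Formula) : Set where
      constructor refutation
      field
        model          : Model
        forces         : All (model ⊩_) Γ
        forcesAbove    : All (ForcesAbove model) L
        refutes        : All (λ A → ¬ model ⊩ A) Δ
        refutesLiteral : All (RefutesLiteral model) R

    Result : (Γ L Δ R : List Formula) → Set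
    Result Γ L Δ R =
      Derivable (_∈ X) (Γ ++ L ⇒ Δ ++ R) ⊎ Refutation Γ L Δ R

    -- The ways to continue when only literals remain: an atom closes the sequent, and a box whose
    -- right premise may stay open leaves only the left premise to derive.
    data Usable (L : List Formula) : Formula → Set where
      axiom : ∀ {p} → atom p ∈ L → Usable L (atom p)
      box   : ∀ {A} → rightPremise (boxes L) A ∈ X → Usable L (□ A)

    Unusable : List Formula → Formula → Set
    Unusable L bot      = ⊤
    Unusable L (atom p) = ¬ atom p ∈ L
    Unusable L (A ⊃ B)  = ⊤
    Unusable L (□ A)    = Countermodel (rightPremise (boxes L) A)

    usable? : ∀ L {A} → A ∈ U → Usable L A ⊎ Unusable L A
    usable? L {bot} i = inj₂ tt
    usable? L {atom p} i with atom p ∈? L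
    ... | yes j = inj₁ (axiom j)
    ... | no ¬j = inj₂ ¬j
    usable? L {A ⊃ B} i = inj₂ tt
    usable? L {□ A} i with decided (rightPremise∈ L (closed □◁ i))
    ... | inj₁ j = inj₁ (box j)
    ... | inj₂ m = inj₂ m

    -- These become the children of the root of the countermodel.
    submodels : ∀ {L R} → All (Unusable L) R → List Model
    submodels [] = []
    submodels {R = □ A ∷ R}    ((m , _) ∷ us) = m ∷ submodels us
    submodels {R = bot ∷ R}    (_ ∷ us) = submodels us
    submodels {R = atom _ ∷ R} (_ ∷ us) = submodels us
    submodels {R = _ ⊃ _ ∷ R}  (_ ∷ us) = submodels us

    -- Each submodel refutes a right premise whose antecedent contains `□ B`, by the choice of
    -- `boxes L`.
    submodels-force : ∀ {L R B} (us : All (Unusable L) R) → □ B ∈ U → □ B ∈ L →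
      All (_⊩ □ B) (submodels us)
    submodels-force [] i j = []
    submodels-force {R = □ A ∷ R} ((m , γ , _) ∷ us) i j =
      All.lookup (All.map⁻ γ) (∈-filter⁺ _ (∈-boxed⁺ i) j) ∷ submodels-force us i j
    submodels-force {R = bot ∷ R}    (_ ∷ us) = submodels-force us
    submodels-force {R = atom _ ∷ R} (_ ∷ us) = submodels-force us
    submodels-force {R = _ ⊃ _ ∷ R}  (_ ∷ us) = submodels-force us

    forces-literals : ∀ {L ms} → (∀ {B} → □ B ∈ L → All (_⊩ □ B) ms) →
      All (ForcesAbove (world L ms)) L
    forces-literals {L} {ms} above-forced = All.tabulate force
      where
      force : ∀ {A} → A ∈ L → ForcesAbove (world L ms) A
      force {bot}    i = tt
      force {atom p} i = i
      force {A ⊃ B}  i = tt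
      force {□ B}    i = above-forced i

    -- The children `ms` stay fixed while the recursion consumes `us`.
    refutes-literals : ∀ {L R} ms (us : All (Unusable L) R) →
      (∀ {m} → m ∈ submodels us → m ∈ ms) → All (RefutesLiteral (world L ms)) R
    refutes-literals ms [] sub = []
    refutes-literals {R = bot ∷ R}    ms (_ ∷ us) sub = tt ∷ refutes-literals ms us sub
    refutes-literals {R = atom p ∷ R} ms (u ∷ us) sub = u ∷ refutes-literals ms us sub
    refutes-literals {R = _ ⊃ _ ∷ R}  ms (_ ∷ us) sub = tt ∷ refutes-literals ms us sub
    refutes-literals {R = □ A ∷ R} ms ((m , _ , ¬a ∷ []) ∷ us) sub =
      (λ b → ¬a (b m (above (lose (sub (here refl)) here))))
      ∷ refutes-literals ms us (sub ∘ there)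

    -- Filing a formula in `R` saves one, and a box is two larger than its body, so that trading
    -- `□ A` in `R` for `A` in `Δ` still saves one. Formulas filed in `L` never return and count
    -- nothing.
    measure : (Γ Δ R : List Formula) → ℕ
    measure Γ Δ R = weight Γ + (weight Δ + sizes R)

    sizes-extract : ∀ A R₁ R₂ → sizes (R₁ ++ A ∷ R₂) ≡ size A + sizes (R₁ ++ R₂)
    sizes-extract A R₁ R₂ = sum-↭ (↭-map⁺ size (shift A R₁ R₂))

    ⊃ˡ-decreases : ∀ a b g x → suc (suc a + suc b) + g + x ≡ suc (suc b + g + x + suc a)
    ⊃ˡ-decreases = solve-∀

    ⊃ˡ-decreases′ : ∀ a b g x y → suc (suc a + suc b) + g + (x + y) ≡
      suc (g + (suc a + x + y) + suc b)
    ⊃ˡ-decreases′ = solve-∀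

    □ˡ-decreases : ∀ b g x → suc (suc (suc b)) + g + x ≡ suc (suc b + g + x + 1)
    □ˡ-decreases = solve-∀

    ⊃ʳ-decreases : ∀ a b d x → suc (suc a + suc b) + d + x ≡
      suc (suc a + 0 + (suc b + d + x) + 0)
    ⊃ʳ-decreases = solve-∀

    □ʳ-decreases : ∀ a d x → suc (suc (suc a)) + d + x ≡ suc (d + (suc (suc a) + x) + 0)
    □ʳ-decreases = solve-∀

    box-decreases : ∀ a x → suc (suc a) + x ≡ suc (suc a + 0 + x + 0)
    box-decreases = solve-∀

    -- A model refuting a premise that is searched also refutes the conclusion, so no choice of rule
    -- is ever revised: either all searched premises are derivable or one refutation settles the
    -- sequent.
    saturate : ∀ Γ L Δ R → Acc _<_ (measure Γ Δ R) →
      Γ ⊆U → L ⊆U → Δ ⊆U → R ⊆U → Result Γ L Δ R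
    saturate (bot ∷ Γ) L Δ R _ _ _ _ _ =
      inj₁ (derive (infer (init-bot (Γ ++ L) (Δ ++ R))) ≈-refl no-premise)
    saturate (atom p ∷ Γ) L Δ R (acc rs) (i ∷ γ) l δ r
      with saturate Γ (atom p ∷ L) Δ R (rs ℕ.≤-refl) γ (i ∷ l) δ r
    ... | inj₁ d = inj₁ (Derivable-resp-≈ (↭-sym (shift (atom p) Γ L) , ↭-refl) d)
    ... | inj₂ (refutation m fs (f ∷ ls) gs ks) = inj₂ (refutation m (f ∷ fs) ls gs ks)
    saturate (A ⊃ B ∷ Γ) L Δ R (acc rs) (i ∷ γ) l δ r
      with saturate (B ∷ Γ) L Δ R
             (rs (≡+⇒< (suc (size A)) (⊃ˡ-decreases (size A) (size B) (weight Γ) _)))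
             (closed ⊃ʳ i ∷ γ) l δ r
         | saturate Γ L (A ∷ Δ) R
             (rs (≡+⇒< (suc (size B)) (⊃ˡ-decreases′ (size A) (size B) (weight Γ) _ _)))
             γ l (closed ⊃ˡ i ∷ δ) r
    ... | inj₂ (refutation m (f ∷ fs) ls gs ks) | _ =
      inj₂ (refutation m ((λ _ → f) ∷ fs) ls gs ks)
    ... | inj₁ _ | inj₂ (refutation m fs ls (g ∷ gs) ks) =
      inj₂ (refutation m ((λ a → contradiction a g) ∷ fs) ls gs ks)
    ... | inj₁ d | inj₁ e =
      inj₁ (derive (infer (→L _ _ A B)) ≈-refl (two-premises (inj₁ d) (inj₁ e)))
    saturate (□ B ∷ Γ) L Δ R (acc rs) (i ∷ γ) l δ r
      with saturate (B ∷ Γ) (□ B ∷ L) Δ R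
             (rs (≡+⇒< 1 (□ˡ-decreases (size B) (weight Γ) _)))
             (closed □◁ i ∷ γ) (i ∷ l) δ r
    ... | inj₁ d =
      inj₁ (derive (infer (reflL (Γ ++ L) (Δ ++ R) B)) ≈-refl
        (one-premise (inj₁ (Derivable-resp-≈
          (prep B (↭-sym (shift (□ B) Γ L)) , ↭-refl) d))))
    -- `B` at the root and `□ B` at all children together give `□ B` at the root.
    ... | inj₂ (refutation (world V ms) (f ∷ fs) (b ∷ ls) gs ks) =
      inj₂ (refutation (world V ms) (⊩-□⁺ f b ∷ fs) ls gs ks)
    saturate [] L (bot ∷ Δ) R (acc rs) γ l (i ∷ δ) r
      with saturate [] L Δ (bot ∷ R) (rs ℕ.≤-refl) γ l δ (i ∷ r)
    ... | inj₁ d = inj₁ (Derivable-resp-≈ (↭-refl , ↭-sym (shift bot Δ R)) d)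
    ... | inj₂ (refutation m fs ls gs (_ ∷ ks)) = inj₂ (refutation m fs ls (id ∷ gs) ks)
    saturate [] L (atom p ∷ Δ) R (acc rs) γ l (i ∷ δ) r
      with saturate [] L Δ (atom p ∷ R) (rs ℕ.≤-refl) γ l δ (i ∷ r)
    ... | inj₁ d = inj₁ (Derivable-resp-≈ (↭-refl , ↭-sym (shift (atom p) Δ R)) d)
    ... | inj₂ (refutation m fs ls gs (k ∷ ks)) = inj₂ (refutation m fs ls (k ∷ gs) ks)
    saturate [] L (A ⊃ B ∷ Δ) R (acc rs) γ l (i ∷ δ) r
      with saturate [ A ] L (B ∷ Δ) R
             (rs (≡+⇒< 0 (⊃ʳ-decreases (size A) (size B) (weight Δ) _)))
             (closed ⊃ˡ i ∷ []) l (closed ⊃ʳ i ∷ δ) r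
    ... | inj₁ d =
      inj₁ (derive (infer (→R L (Δ ++ R) A B)) ≈-refl (one-premise (inj₁ d)))
    ... | inj₂ (refutation m (a ∷ []) ls (¬b ∷ gs) ks) =
      inj₂ (refutation m [] ls ((λ f → ¬b (f a)) ∷ gs) ks)
    saturate [] L (□ A ∷ Δ) R (acc rs) γ l (i ∷ δ) r
      with saturate [] L Δ (□ A ∷ R)
             (rs (≡+⇒< 0 (□ʳ-decreases (size A) (weight Δ) _))) γ l δ (i ∷ r)
    ... | inj₁ d = inj₁ (Derivable-resp-≈ (↭-refl , ↭-sym (shift (□ A) Δ R)) d)
    ... | inj₂ (refutation m fs ls gs (k ∷ ks)) = inj₂ (refutation m fs ls (k ∷ gs) ks)
    saturate [] L [] R (acc rs) γ l δ r with any⊎all (All.map (usable? L) r)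
    ... | inj₂ us =
      inj₂ (refutation (world L (submodels us)) []
        (forces-literals λ i → submodels-force us (All.lookup l i) i) []
        (refutes-literals _ us id))
    ... | inj₁ u with find u
    ...   | atom p , j , axiom i
      with L₁ , L₂ , refl ← ∈-∃++ i | R₁ , R₂ , refl ← ∈-∃++ j =
      inj₁ (derive (infer (init-atom (L₁ ++ L₂) (R₁ ++ R₂) p))
        (shift (atom p) L₁ L₂ , shift (atom p) R₁ R₂) no-premise)
    ...   | □ A , j , box x
      with R₁ , R₂ , refl ← ∈-∃++ j
      with i ∷ r′ ← All-resp-↭ (shift (□ A) R₁ R₂) r
      with saturate [] L [ A ] (R₁ ++ R₂)
             (rs (≡+⇒< 0 (trans (sizes-extract (□ A) R₁ R₂) (box-decreases (size A) _))))
             [] l (closed □◁ i ∷ []) r′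
    -- By reflexivity, refuting `A` at `m` refutes `□ A` there.
    ... | inj₂ (refutation m fs ls (¬a ∷ []) ks) =
      inj₂ (refutation m [] ls []
        (All-resp-↭ (↭-sym (shift (□ A) R₁ R₂)) ((λ b → ¬a (b m here)) ∷ ks)))
    ... | inj₁ d =
      -- `Γ` absorbs the rest of `L` after one copy of each of its boxed formulas is split off.
      let Γ , p = boxes-split L in
      inj₁ (derive (infer (box Γ (boxes L) (R₁ ++ R₂) A)) (p , shift (□ A) R₁ R₂)
        (two-premises (inj₁ (Derivable-resp-≈ (↭-sym p , ↭-refl) d))
                      (inj₂ (right , x))))

    derivable⊎countermodel : ∀ Γ Δ → Γ ⊆U → Δ ⊆U →
      Derivable (_∈ X) (Γ ⇒ Δ) ⊎ Countermodel (Γ ⇒ Δ)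
    derivable⊎countermodel Γ Δ γ δ
      with saturate Γ [] Δ [] (<-wellFounded _) γ [] δ []
    ... | inj₁ d = inj₁ (Derivable-resp-≈
      (↭-reflexive (sym (++-identityʳ Γ)) , ↭-reflexive (sym (++-identityʳ Δ))) d)
    ... | inj₂ (refutation m fs _ gs _) = inj₂ (m , fs , gs)

  -- Deletion of refutable right premises

  open Saturate using (derivable⊎countermodel)

  -- A sequent is deleted only when a countermodel to it is at hand, which preserves `decided`; the
  -- list shrinks until it is closed under expansion.
  refine : ∀ X → Acc _<_ (length X) →
    (∀ {S} → S ∈ X → S ∈ rightPremises) →
    (∀ {S} → S ∈ rightPremises → S ∈ X ⊎ Countermodel S) →
    ∃ λ X′ → (∀ {S} → S ∈ X′ → Derivable (_∈ X′) S)
           × (∀ {S} → S ∈ rightPremises → S ∈ X′ ⊎ Countermodel S)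
  refine X (acc rs) X⊆ decided
    with any⊎all (All.tabulate λ i →
      swap (derivable⊎countermodel X decided _ _
        (proj₁ (rightPremises⊆U (X⊆ i))) (proj₂ (rightPremises⊆U (X⊆ i)))))
  ... | inj₂ ds = X , All.lookup ds , decided
  ... | inj₁ i with T , j , m ← find i with X₁ , X₂ , refl ← ∈-∃++ j =
    refine (X₁ ++ X₂) (rs shorter) (X⊆ ∘ weaken) decided′
    where
    shorter : length (X₁ ++ X₂) < length (X₁ ++ T ∷ X₂)
    shorter rewrite length-++ X₁ {X₂} | length-++ X₁ {T ∷ X₂}
                  | ℕ.+-suc (length X₁) (length X₂) = ℕ.≤-refl

    weaken : ∀ {S} → S ∈ X₁ ++ X₂ → S ∈ X₁ ++ T ∷ X₂
    weaken i with ∈-++⁻ X₁ i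
    ... | inj₁ k = ∈-++⁺ˡ k
    ... | inj₂ k = ∈-++⁺ʳ X₁ (there k)

    decided′ : ∀ {S} → S ∈ rightPremises → S ∈ X₁ ++ X₂ ⊎ Countermodel S
    decided′ s with decided s
    ... | inj₂ n = inj₂ n
    ... | inj₁ k with ∈-++⁻ X₁ k
    ...   | inj₁ k′          = inj₁ (∈-++⁺ˡ k′)
    ...   | inj₂ (here refl) = inj₂ m
    ...   | inj₂ (there k′)  = inj₁ (∈-++⁺ʳ X₁ k′)

  provable⊎countermodel : ∀ Γ Δ → Γ ⊆U → Δ ⊆U →
    Provable Grz∞ (Γ ⇒ Δ) ⊎ Countermodel (Γ ⇒ Δ)
  provable⊎countermodel Γ Δ γ δ
    with X , expand , decided ← refine rightPremises (<-wellFounded _) id inj₁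
    with derivable⊎countermodel X decided Γ Δ γ δ
  ... | inj₁ d = inj₁ (postfixed⇒provable expand d)
  ... | inj₂ m = inj₂ m

provable⊎countermodel : ∀ Γ Δ → Provable Grz∞ (Γ ⇒ Δ) ⊎ Countermodel (Γ ⇒ Δ)
provable⊎countermodel Γ Δ =
  Search.provable⊎countermodel (concatMap subformulas (Γ ++ Δ))
    (concatMap-subformulas-closed (Γ ++ Δ)) Γ Δ (All.++⁻ˡ Γ all∈) (All.++⁻ʳ Γ all∈)
  where
  all∈ : All (_∈ concatMap subformulas (Γ ++ Δ)) (Γ ++ Δ)
  all∈ = All.tabulate λ i → ∈-concatMap⁺ subformulas (lose i (self∈subformulas _))

theorem6p6 : (Γ Δ : List Formula) → Provable Grz∞+cut (Γ ⇒ Δ) → Provable Grz∞ (Γ ⇒ Δ)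
theorem6p6 Γ Δ (t , proof) with provable⊎countermodel Γ Δ
... | inj₁ p         = p
... | inj₂ (m , ref) = ⊥-elim (unrefutable t proof m ref)
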